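{- Let $n\ge1$, $G=\mathbb F_2^n$, $B\subseteq G$, $K\ge1$, and $\eta\in[0,1)$, and suppose that $\mathfrak A(B;K,\eta)\ne\varnothing$. Then there is a subspace $V_{B,K,\eta}\le G$ such that, simultaneously for every $A\in\mathfrak A(B;K,\eta)$, $$|V_{B,K,\eta}|\le|A|\qquad\text{and}\qquad \mathcal N_{V_{B,K,\eta}}(A)\le\frac{2K}{1-\eta}P_{\rm PFR}(K).$$
   Context: For $S,T\subseteq\mathbb F_2^n$, $S+T=\{s+t:s\in S,t\in T\}$; $\triangle$ is symmetric difference. For a subspace $V$ and a set $S$, $\mathcal N_V(S)=\min\{|T|:S\subseteq T+V\}$ is the minimum number of $V$-cosets needed to cover $S$. Compatibility class: $\mathfrak A(B;K,\eta)=\{A\subseteq\mathbb F_2^n: A\ne\varnothing,\ |A+A|\le K|A|,\ |A\triangle B|\le\eta|A|\}$. $P_{\rm PFR}:[1,\infty)\to[1,\infty)$ is a nondecreasing polynomial, fixed once and for all together with a nondecreasing computable function $F_{\rm PFR}$, having the following property (size-oblivious algorithmic PFR): there is a randomized algorithm which, given $K\ge1$, $\rho\in(0,1)$, deterministic membership access to a nonempty $A\subseteq\mathbb F_2^n$ with $|A+A|\le K|A|$, and independent exact uniform samples from $A$ (but not $|A|$), outputs with probability at least $1-\rho$ a basis of a subspace $V\le\mathbb F_2^n$ with $|V|\le|A|$ and $\mathcal N_V(A)\le P_{\rm PFR}(K)$, using $O(n+\log(1/\rho))$ samples and at most $F_{\rm PFR}(K)\operatorname{poly}(n,\log(1/\rho))$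 membership queries and running time. In particular, every nonempty $A\subseteq\mathbb F_2^n$ with $|A+A|\le K|A|$ admits a subspace $V$ with $|V|\le|A|$ and $\mathcal N_V(A)\le P_{\rm PFR}(K)$. -}

module Defs where

open import Algebra.Bundles using (CommutativeRing)
open import Data.Bool.Base using (Bool; true; false; _∧_; _xor_; T)
open import Data.Bool.Properties as Bool using (T?; T-∧; xor-identityʳ)
open import Data.List.Base using (List; []; _∷_; _++_; map; any; foldr; filter; filterᵇ; length; cartesianProductWith)
open import Data.List.Extrema.Nat using (min; argmin-sel; min≤v⁺)
open import Data.List.Membership.Propositional using (lose) renaming (_∈_ to _∈ˡ_)
open import Data.List.Membership.Propositional.Properties using (∈-map⁺; ∈-map⁻; ∈-++⁺ˡ; ∈-++⁺ʳ; ∈-cartesianProductWith⁺; ∈-filter⁺; ∈-filter⁻)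
open import Data.List.Properties using (filter-≐)
open import Data.List.Relation.Unary.All as All using (all?)
open import Data.List.Relation.Unary.Any as Any using (here; there)
open import Data.List.Relation.Unary.Any.Properties using (any⁺; any⁻)
open import Data.Nat.Base as ℕ using (ℕ; zero; suc)
import Data.Nat.Properties as ℕ
open import Data.Product.Base using (∃; ∃-syntax; _×_; _,_; proj₁; proj₂)
open import Data.Sum.Base using (inj₁; inj₂)
open import Data.Vec.Base as Vec using (Vec; []; _∷_; zipWith; replicate)
open import Data.Vec.Properties using (≡-dec; zipWith-identityʳ)
open import Function.Base using (_∘_)
open import Function.Bundles using (Equivalence)
open import Level using (_⊔_) renaming (suc to lsuc)
open import Relation.Binary.Core using (Rel)
open import Relation.Binary.PropositionalEquality.Core using (_≡_; refl; sym; cong; subst; _≗_)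
open import Relation.Binary.Structures using (IsDecTotalOrder)
open import Relation.Nullary.Decidable.Core using (Dec; ⌊_⌋; map′; _→-dec_; fromWitness; toWitness)
open import Relation.Nullary.Negation.Core using (¬_)
open import Relation.Unary using (Pred)

------------------------------------------------------------------------
-- The vector space 𝔽₂ⁿ

-- 𝔽₂ is Bool with addition _xor_ and multiplication _∧_
-- (see Data.Bool.Properties.xor-∧-commutativeRing).

𝔽₂^_ : ℕ → Set
𝔽₂^ n = Vec Bool n

infixl 6 _+ᵥ_
infixr 7 _·ᵥ_

0ᵥ : ∀ {n} → 𝔽₂^ n
0ᵥ = replicate _ false

_+ᵥ_ : ∀ {n} → 𝔽₂^ n → 𝔽₂^ n → 𝔽₂^ n
_+ᵥ_ = zipWith _xor_

_·ᵥ_ : ∀ {n} → Bool → 𝔽₂^ n → 𝔽₂^ n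
c ·ᵥ x = Vec.map (c ∧_) x

infix 4 _≟_

_≟_ : ∀ {n} (x y : 𝔽₂^ n) → Dec (x ≡ y)
_≟_ = ≡-dec Bool._≟_

points : ∀ n → List (𝔽₂^ n)
points zero    = [] ∷ []
points (suc n) = map (false ∷_) (points n) ++ map (true ∷_) (points n)

∈-points : ∀ {n} (x : 𝔽₂^ n) → x ∈ˡ points n
∈-points []          = here refl
∈-points (false ∷ x) = ∈-++⁺ˡ (∈-map⁺ (false ∷_) (∈-points x))
∈-points (true  ∷ x) = ∈-++⁺ʳ _ (∈-map⁺ (true ∷_) (∈-points x))

------------------------------------------------------------------------
-- Subsets of 𝔽₂ⁿ, as characteristic functions

Subset : ℕ → Set
Subset n = 𝔽₂^ n → Bool

infix 4 _∈_ _⊆_ _⊆?_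
infixl 6 _⊕_ _△_

_∈_ : ∀ {n} → 𝔽₂^ n → Subset n → Set
x ∈ S = T (S x)

Nonempty : ∀ {n} → Subset n → Set
Nonempty S = ∃[ x ] x ∈ S

_⊆_ : ∀ {n} → Subset n → Subset n → Set
S ⊆ U = ∀ x → x ∈ S → x ∈ U

_⊆?_ : ∀ {n} (S U : Subset n) → Dec (S ⊆ U)
S ⊆? U = map′ (λ p x → All.lookup p (∈-points x)) (λ p → All.universal p _)
              (all? (λ x → T? (S x) →-dec T? (U x)) (points _))

∣_∣ : ∀ {n} → Subset n → ℕ
∣_∣ {n} S = length (filterᵇ S (points n))

_△_ : ∀ {n} → Subset n → Subset n → Subset n
(S △ U) x = S x xor U x

-- The sumset {s + t : s ∈ S, t ∈ U}.
_⊕_ : ∀ {n} → Subset n → Subset n → Subset n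
_⊕_ {n} S U x = any (λ s → any (λ t → S s ∧ U t ∧ ⌊ s +ᵥ t ≟ x ⌋) (points n)) (points n)

∈-⊕⁺ : ∀ {n} {S U : Subset n} {s t} → s ∈ S → t ∈ U → s +ᵥ t ∈ S ⊕ U
∈-⊕⁺ {s = s} {t} s∈S t∈U =
  any⁺ _ (lose (∈-points s) (any⁺ _ (lose (∈-points t)
    (Equivalence.from T-∧ (s∈S , Equivalence.from T-∧ (t∈U , fromWitness refl))))))

∈-⊕⁻ : ∀ {n} {S U : Subset n} {x} → x ∈ S ⊕ U →
       ∃[ s ] ∃[ t ] s ∈ S × t ∈ U × s +ᵥ t ≡ x
∈-⊕⁻ {n} {S} {U} {x} p =
  let s , q  = Any.satisfied (any⁻ _ (points n) p)
      t , r  = Any.satisfied (any⁻ _ (points n) q)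
      s∈S , r′ = Equivalence.to (T-∧ {S s}) r
      t∈U , e  = Equivalence.to (T-∧ {U t}) r′
  in s , t , s∈S , t∈U , toWitness e

record Subspace (n : ℕ) : Set where
  field
    carrier  : Subset n
    0∈       : 0ᵥ ∈ carrier
    +-closed : ∀ {x y} → x ∈ carrier → y ∈ carrier → x +ᵥ y ∈ carrier
    ·-closed : ∀ c {x} → x ∈ carrier → c ·ᵥ x ∈ carrier

open Subspace public using (carrier)

------------------------------------------------------------------------
-- Covering numbers

-- All subsets of 𝔽₂ⁿ, each occurring once up to pointwise equality.
subsets : ∀ n → List (Subset n)
subsets zero    = (λ _ → false) ∷ (λ _ → true) ∷ []
subsets (suc n) = cartesianProductWith glue (subsets n) (subsets n)
  where
  glue : Subset n → Subset n → Subset (suc n)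
  glue S U (false ∷ x) = S x
  glue S U (true  ∷ x) = U x

-- 𝒩 V S = min { |U| : S ⊆ U + V }.  The value ∣ S ∣, which `min` takes as its
-- default, is the one given by U = S, as S ⊆ S + V; so it does not change the
-- minimum (see 𝒩-attained and 𝒩-minimal).
𝒩 : ∀ {n} → Subspace n → Subset n → ℕ
𝒩 {n} V S = min ∣ S ∣ (map ∣_∣ (filter (λ U → S ⊆? U ⊕ carrier V) (subsets n)))

⊆-⊕ : ∀ {n} (V : Subspace n) (S : Subset n) → S ⊆ S ⊕ carrier V
⊆-⊕ V S x x∈S =
  subst (_∈ S ⊕ carrier V) (zipWith-identityʳ {f = _xor_} {e = false} xor-identityʳ x)
        (∈-⊕⁺ {S = S} {U = carrier V} {s = x} x∈S (Subspace.0∈ V))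

subsets-complete : ∀ {n} (S : Subset n) → ∃[ S′ ] S′ ∈ˡ subsets n × S ≗ S′
subsets-complete {zero} S with S [] in eq
... | false = _ , here refl         , λ { [] → eq }
... | true  = _ , there (here refl) , λ { [] → eq }
subsets-complete {suc n} S =
  let _ , p , f = subsets-complete (S ∘ (false ∷_))
      _ , q , g = subsets-complete (S ∘ (true ∷_))
  in _ , ∈-cartesianProductWith⁺ _ p q , λ { (false ∷ x) → f x ; (true ∷ x) → g x }

∣∣-cong : ∀ {n} {S U : Subset n} → S ≗ U → ∣ S ∣ ≡ ∣ U ∣
∣∣-cong {n} {S} {U} S≗U =
  cong length (filter-≐ (T? ∘ S) (T? ∘ U)
    ((λ {x} → subst T (S≗U x)) , (λ {x} → subst T (sym (S≗U x)))) (points n))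

𝒩-attained : ∀ {n} (V : Subspace n) (S : Subset n) →
             ∃[ U ] S ⊆ U ⊕ carrier V × ∣ U ∣ ≡ 𝒩 V S
𝒩-attained {n} V S
  with argmin-sel (λ m → m) ∣ S ∣ (map ∣_∣ (filter (λ U → S ⊆? U ⊕ carrier V) (subsets n)))
... | inj₁ eq = S , ⊆-⊕ V S , sym eq
... | inj₂ m∈ =
  let U , U∈ , eq = ∈-map⁻ ∣_∣ m∈
  in U , proj₂ (∈-filter⁻ (λ U → S ⊆? U ⊕ carrier V) {xs = subsets n} U∈) , sym eq

𝒩-minimal : ∀ {n} (V : Subspace n) (S U : Subset n) →
            S ⊆ U ⊕ carrier V → 𝒩 V S ℕ.≤ ∣ U ∣
𝒩-minimal V S U S⊆U⊕V =
  let U′ , U′∈ , U≗U′ = subsets-complete U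
      S⊆U′⊕V x x∈S =
        let u , v , u∈U , v∈V , u+v≡x = ∈-⊕⁻ {S = U} {U = carrier V} (S⊆U⊕V x x∈S)
        in subst (_∈ U′ ⊕ carrier V) u+v≡x
                 (∈-⊕⁺ {S = U′} {U = carrier V} (subst T (U≗U′ u) u∈U) v∈V)
  in min≤v⁺ _ _ (inj₂ (lose
       (∈-map⁺ ∣_∣ (∈-filter⁺ (λ U → S ⊆? U ⊕ carrier V) U′∈ S⊆U′⊕V))
       (ℕ.≤-reflexive (sym (∣∣-cong U≗U′)))))

------------------------------------------------------------------------
-- The real numbers

-- The real numbers, given by the classical axioms that determine them up to
-- isomorphism: a Dedekind-complete ordered field.  The order is decidable, as
-- it is in classical mathematics.  The value 0# ⁻¹ is unspecified.
record Reals c ℓ₁ ℓ₂ : Set (lsuc (c ⊔ ℓ₁ ⊔ ℓ₂)) where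
  field
    commutativeRing : CommutativeRing c ℓ₁
  open CommutativeRing commutativeRing public
  infix  8 _⁻¹
  infixl 7 _/_
  infix  4 _≤_ _<_
  field
    _⁻¹             : Carrier → Carrier
    ⁻¹-cong         : ∀ {x y} → x ≈ y → x ⁻¹ ≈ y ⁻¹
    ⁻¹-inverseʳ     : ∀ {x} → ¬ (x ≈ 0#) → x * x ⁻¹ ≈ 1#
    1≉0             : ¬ (1# ≈ 0#)
    _≤_             : Rel Carrier ℓ₂
    isDecTotalOrder : IsDecTotalOrder _≈_ _≤_
    +-monoˡ-≤       : ∀ {x y} z → x ≤ y → x + z ≤ y + z
    *-nonNeg        : ∀ {x y} → 0# ≤ x → 0# ≤ y → 0# ≤ x * y

  UpperBound : Pred Carrier (c ⊔ ℓ₁ ⊔ ℓ₂) → Carrier → Set (c ⊔ ℓ₁ ⊔ ℓ₂)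
  UpperBound S b = ∀ x → S x → x ≤ b

  field
    supremum : ∀ S → ∃ S → ∃ (UpperBound S) →
               ∃[ s ] UpperBound S s × (∀ b → UpperBound S b → s ≤ b)

  _<_ : Carrier → Carrier → Set (ℓ₁ ⊔ ℓ₂)
  x < y = x ≤ y × ¬ (x ≈ y)

  _/_ : Carrier → Carrier → Carrier
  x / y = x * y ⁻¹

  open import Algebra.Properties.Semiring.Mult semiring using () renaming (_×_ to _·ℕ_)

  fromℕ : ℕ → Carrier
  fromℕ m = m ·ℕ 1#

  -- The value at x of the polynomial with the given coefficients, constant
  -- coefficient first.
  evalPoly : List Carrier → Carrier → Carrier
  evalPoly as x = foldr (λ a r → a + x * r) 0# as

------------------------------------------------------------------------

module _ {c ℓ₁ ℓ₂} (ℝ : Reals c ℓ₁ ℓ₂) where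
  open Reals ℝ

  SmallDoubling : ∀ {n} → Carrier → Subset n → Set ℓ₂
  SmallDoubling K A = fromℕ ∣ A ⊕ A ∣ ≤ K * fromℕ ∣ A ∣

  -- 𝔄(B; K, η)
  𝔄 : ∀ {n} → Subset n → Carrier → Carrier → Pred (Subset n) ℓ₂
  𝔄 B K η A = Nonempty A × SmallDoubling K A × fromℕ ∣ A △ B ∣ ≤ η * fromℕ ∣ A ∣

  -- The admissible polynomials P_PFR.  Of the algorithmic Freiman–Ruzsa
  -- property only the existence of the subspace is kept: an admissible P works
  -- for all n, K and A, whether or not V can be found efficiently.
  record PFRPolynomial : Set (c ⊔ ℓ₁ ⊔ ℓ₂) where
    field
      coefficients : List Carrier

    P : Carrier → Carrier
    P = evalPoly coefficients

    field
      P≥1    : ∀ {K} → 1# ≤ K → 1# ≤ P K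
      P-mono : ∀ {K L} → 1# ≤ K → K ≤ L → P K ≤ P L
      pfr    : ∀ {n K} → 1# ≤ K → (A : Subset n) → Nonempty A → SmallDoubling K A →
               ∃[ V ] ∣ carrier V ∣ ℕ.≤ ∣ A ∣ × fromℕ (𝒩 V A) ≤ P K

{-# OPTIONS --safe #-}
-- Let A₀ be a smallest member of the class, V the subspace which the
-- Freiman–Ruzsa property gives for A₀, and U a set of at most P K points with
-- A₀ ⊆ U + V.  For A in the class put C = A ∩ A₀; as A and A₀ are both close
-- to B, (1 - η)(|A| + |A₀|) ≤ 2|C|.  If X ⊆ A represents the cosets of V that
-- meet A, each once, and c ∈ C lies in u(c) + V with u(c) ∈ U, then the map
-- (x , c) ↦ (u(c) , x + c) is injective on X × C, for u(c) is congruent to c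
-- and so determines x = (x + c) + c modulo V.  Hence
-- 𝒩 V A · |C| ≤ |U| · |A + A| ≤ P K · K |A|.
module Submission where

open import Defs
open import Data.Bool.Base using (Bool; true; false; _∧_; _xor_; T)
open import Data.Bool.Properties using (T?; T-∧; xor-comm; not-involutive)
open import Data.Fin.Base using (Fin; zero; suc)
open import Data.Fin.Properties using (injective⇒≤)
open import Data.List.Base using (List; []; _∷_; map; filter; filterᵇ; length; lookup; deduplicate; cartesianProduct)
open import Data.List.Extrema.Nat using (argmin; f[argmin]≤f[xs]; argmin-all)
open import Data.List.Membership.Propositional using (find; lose) renaming (_∈_ to _∈ˡ_)
open import Data.List.Membership.Propositional.Properties using (∈-map⁻; ∈-filter⁺; ∈-filter⁻; ∈-lookup; ∈-length; ∈-cartesianProduct⁺; ∈-cartesianProduct⁻; ∈-deduplicate⁻)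
open import Data.List.Properties using (length-++; length-map)
open import Data.List.Relation.Unary.All as All using ([]; _∷_)
open import Data.List.Relation.Unary.All.Properties using (all-filter)
open import Data.List.Relation.Unary.AllPairs as AllPairs using (AllPairs; []; _∷_)
open import Data.List.Relation.Unary.Any as Any using (here; there; index; any?)
open import Data.List.Relation.Unary.Any.Properties using (lookup-index; deduplicate⁺)
open import Data.List.Relation.Unary.Unique.DecSetoid.Properties using (deduplicate-!)
open import Data.List.Relation.Unary.Unique.Propositional using (Unique)
open import Data.List.Relation.Unary.Unique.Propositional.Properties as Unique using (cartesianProduct⁺)
open import Data.Nat.Base as ℕ using (ℕ; zero; suc; z≤n; s≤s)
import Data.Nat.Properties as ℕ
open import Data.Nat.Solver using (module +-*-Solver)
open import Data.Product.Base using (∃-syntax; _×_; _,_; proj₁; proj₂)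
open import Data.Sum.Base using (inj₁; inj₂)
open import Data.Vec.Base using ([]; _∷_)
open import Data.Vec.Properties using (∷-injectiveʳ; zipWith-comm)
open import Function.Base using (_∘_)
open import Function.Bundles using (Equivalence)
open import Relation.Binary.Bundles using (DecSetoid; Poset)
open import Relation.Binary.PropositionalEquality.Core using (_≡_; refl; sym; trans; cong; cong₂; subst; subst₂; _≗_)
open import Relation.Binary.Structures using (IsDecTotalOrder)
open import Relation.Nullary.Decidable.Core using (Dec; map′; _×-dec_; fromWitness; toWitness; ⌊_⌋)
open import Relation.Nullary.Negation.Core using (¬_; contradiction)
open import Relation.Unary using (Satisfiable)

-- Counting

module _ {a} {A : Set a} where

  lookup-injective : ∀ {xs : List A} → Unique xs → ∀ {i j} →
                     lookup xs i ≡ lookup xs j → i ≡ j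
  lookup-injective (_ ∷ _) {zero}  {zero}  _  = refl
  lookup-injective (x∉ ∷ _) {zero}  {suc j} eq = contradiction eq (All.lookup x∉ (∈-lookup j))
  lookup-injective (x∉ ∷ _) {suc i} {zero}  eq = contradiction (sym eq) (All.lookup x∉ (∈-lookup i))
  lookup-injective (_ ∷ u) {suc i} {suc j} eq = cong suc (lookup-injective u eq)

  -- Pigeonhole for a relation: each position of `xs` is sent to the position of some partner in
  -- `ys`, and left uniqueness makes this map injective. With a relation in place of a function, the
  -- partner may depend on the proof of membership.
  length-≤ : ∀ {b r} {B : Set b} (R : A → B → Set r) {xs : List A} {ys : List B} →
             Unique xs →
             (∀ {x} → x ∈ˡ xs → ∃[ y ] y ∈ˡ ys × R x y) →
             (∀ {x x′ y} → R x y → R x′ y → x ≡ x′) →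
             length xs ℕ.≤ length ys
  length-≤ R {xs} {ys} unique total leftUnique = injective⇒≤ λ {i} {j} eq →
    lookup-injective unique
      (leftUnique (related i) (subst (R (lookup xs j) ∘ lookup ys) (sym eq) (related j)))
    where
    image : Fin (length xs) → Fin (length ys)
    image i = index (proj₁ (proj₂ (total (∈-lookup {xs = xs} i))))

    related : ∀ i → R (lookup xs i) (lookup ys (image i))
    related i = let _ , y∈ , r = total (∈-lookup {xs = xs} i)
                in subst (R (lookup xs i)) (lookup-index y∈) r

  length-cartesianProduct : ∀ {b} {B : Set b} (xs : List A) (ys : List B) →
                            length (cartesianProduct xs ys) ≡ length xs ℕ.* length ys
  length-cartesianProduct []       ys = refl
  length-cartesianProduct (x ∷ xs) ys =
    trans (length-++ (map (x ,_) ys))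
          (cong₂ ℕ._+_ (length-map (x ,_) ys) (length-cartesianProduct xs ys))

  -- Writing the share of the head as a count over a one-element list separates it from the tail and
  -- lets it compute from the Boolean `p x`.
  count-∷ : ∀ (p : A → Bool) x xs →
            length (filterᵇ p (x ∷ xs)) ≡ length (filterᵇ p (x ∷ [])) ℕ.+ length (filterᵇ p xs)
  count-∷ p x xs with p x
  ... | true  = refl
  ... | false = refl

  -- Holds point by point. A point in both `p` and `q` gives 2 on the left and at least 2 on the
  -- right; if it is in exactly one of them, then exactly one of `p` and `q` disagrees with `r`
  -- there, so both sides get 1.
  count-∧-△ : ∀ (p q r : A → Bool) xs →
    length (filterᵇ p xs) ℕ.+ length (filterᵇ q xs) ℕ.≤
    2 ℕ.* length (filterᵇ (λ x → p x ∧ q x) xs) ℕ.+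
      (length (filterᵇ (λ x → p x xor r x) xs) ℕ.+ length (filterᵇ (λ x → q x xor r x) xs))
  count-∧-△ p q r []       = z≤n
  count-∧-△ p q r (x ∷ xs)
    rewrite count-∷ p x xs | count-∷ q x xs | count-∷ (λ x → p x ∧ q x) x xs
          | count-∷ (λ x → p x xor r x) x xs | count-∷ (λ x → q x xor r x) x xs = begin
    (p₁ ℕ.+ p∗) ℕ.+ (q₁ ℕ.+ q∗)
      ≡⟨ solve 4 (λ a b c d → (a :+ b) :+ (c :+ d) := (a :+ c) :+ (b :+ d)) refl p₁ p∗ q₁ q∗ ⟩
    (p₁ ℕ.+ q₁) ℕ.+ (p∗ ℕ.+ q∗)
      ≤⟨ ℕ.+-mono-≤ at-x (count-∧-△ p q r xs) ⟩
    (2 ℕ.* b₁ ℕ.+ (d₁ ℕ.+ e₁)) ℕ.+ (2 ℕ.* b∗ ℕ.+ (d∗ ℕ.+ e∗))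
      ≡⟨ solve 6 (λ b b′ d d′ e e′ →
           (con 2 :* b :+ (d :+ e)) :+ (con 2 :* b′ :+ (d′ :+ e′))
           := con 2 :* (b :+ b′) :+ ((d :+ d′) :+ (e :+ e′))) refl b₁ b∗ d₁ d∗ e₁ e∗ ⟩
    2 ℕ.* (b₁ ℕ.+ b∗) ℕ.+ ((d₁ ℕ.+ d∗) ℕ.+ (e₁ ℕ.+ e∗)) ∎
    where
    open ℕ.≤-Reasoning
    open +-*-Solver using (solve; _:+_; _:*_; _:=_; con)
    count : (A → Bool) → List A → ℕ
    count s ys = length (filterᵇ s ys)
    p₁ = count p (x ∷ [])
    p∗ = count p xs
    q₁ = count q (x ∷ [])
    q∗ = count q xs
    b₁ = count (λ y → p y ∧ q y) (x ∷ [])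
    b∗ = count (λ y → p y ∧ q y) xs
    d₁ = count (λ y → p y xor r y) (x ∷ [])
    d∗ = count (λ y → p y xor r y) xs
    e₁ = count (λ y → q y xor r y) (x ∷ [])
    e∗ = count (λ y → q y xor r y) xs

    at-x : p₁ ℕ.+ q₁ ℕ.≤ 2 ℕ.* b₁ ℕ.+ (d₁ ℕ.+ e₁)
    at-x with p x | q x | r x
    ... | true  | true  | true  = s≤s (s≤s z≤n)
    ... | true  | true  | false = s≤s (s≤s z≤n)
    ... | true  | false | true  = s≤s z≤n
    ... | true  | false | false = s≤s z≤n
    ... | false | true  | true  = s≤s z≤n
    ... | false | true  | false = s≤s z≤n
    ... | false | false | true  = z≤n
    ... | false | false | false = z≤n

-- Subsets of 𝔽₂ⁿ

points-unique : ∀ n → Unique (points n)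
points-unique zero    = [] ∷ []
points-unique (suc n) =
  Unique.++⁺ (Unique.map⁺ ∷-injectiveʳ (points-unique n))
             (Unique.map⁺ ∷-injectiveʳ (points-unique n))
             disjoint
  where
  disjoint : ∀ {x} → ¬ (x ∈ˡ map (false ∷_) (points n) × x ∈ˡ map (true ∷_) (points n))
  disjoint (p , q) with ∈-map⁻ (false ∷_) p | ∈-map⁻ (true ∷_) q
  ... | _ , _ , refl | _ , _ , ()

module _ {n : ℕ} where

  members : Subset n → List (𝔽₂^ n)
  members S = filterᵇ S (points n)

  ∈-members⁺ : ∀ S {x} → x ∈ S → x ∈ˡ members S
  ∈-members⁺ S x∈S = ∈-filter⁺ (T? ∘ S) (∈-points _) x∈S

  ∈-members⁻ : ∀ S {x} → x ∈ˡ members S → x ∈ S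
  ∈-members⁻ S = proj₂ ∘ ∈-filter⁻ (T? ∘ S) {xs = points n}

  members-unique : ∀ S → Unique (members S)
  members-unique S = Unique.filter⁺ (T? ∘ S) (points-unique n)

  infixl 7 _∩_

  _∩_ : Subset n → Subset n → Subset n
  (S ∩ U) x = S x ∧ U x

  fromList : List (𝔽₂^ n) → Subset n
  fromList xs x = ⌊ any? (x ≟_) xs ⌋

  ∣fromList∣≤length : ∀ xs → ∣ fromList xs ∣ ℕ.≤ length xs
  ∣fromList∣≤length xs = length-≤ _≡_ (members-unique (fromList xs))
    (λ x∈ → _ , toWitness (∈-members⁻ (fromList xs) x∈) , refl)
    (λ { refl refl → refl })

  ∣∣-mono-⊆ : ∀ (S U : Subset n) → S ⊆ U → ∣ S ∣ ℕ.≤ ∣ U ∣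
  ∣∣-mono-⊆ S U S⊆U = length-≤ _≡_ (members-unique S)
    (λ x∈ → _ , ∈-members⁺ U (S⊆U _ (∈-members⁻ S x∈)) , refl)
    (λ { refl refl → refl })

  Nonempty⇒0<∣∣ : ∀ (S : Subset n) → Nonempty S → 0 ℕ.< ∣ S ∣
  Nonempty⇒0<∣∣ S (_ , x∈S) = ∈-length (∈-members⁺ S x∈S)

  nonempty? : ∀ (S : Subset n) → Dec (Nonempty S)
  nonempty? S = map′ Any.satisfied (λ (x , x∈S) → lose (∈-points x) x∈S)
                     (any? (T? ∘ S) (points n))

  ⊕-mono-⊆ : ∀ (S S′ U U′ : Subset n) → S ⊆ S′ → U ⊆ U′ → S ⊕ U ⊆ S′ ⊕ U′
  ⊕-mono-⊆ S S′ U U′ S⊆S′ U⊆U′ x x∈ =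
    let _ , _ , s∈S , u∈U , eq = ∈-⊕⁻ {S = S} {U = U} x∈
    in subst (_∈ S′ ⊕ U′) eq (∈-⊕⁺ {S = S′} {U = U′} (S⊆S′ _ s∈S) (U⊆U′ _ u∈U))

-- Cosets

+ᵥ-comm : ∀ {n} (x y : 𝔽₂^ n) → x +ᵥ y ≡ y +ᵥ x
+ᵥ-comm = zipWith-comm xor-comm

-- In characteristic 2 a sum is also a difference, and the two copies of `y` cancel. This gives
-- transitivity of congruence modulo a subspace.
+ᵥ-telescope : ∀ {n} (x y z : 𝔽₂^ n) → (x +ᵥ y) +ᵥ (y +ᵥ z) ≡ x +ᵥ z
+ᵥ-telescope []      []      []      = refl
+ᵥ-telescope (a ∷ x) (b ∷ y) (c ∷ z) = cong₂ _∷_ (bits a b c) (+ᵥ-telescope x y z)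
  where
  bits : ∀ a b c → (a xor b) xor (b xor c) ≡ a xor c
  bits true  true  true  = refl
  bits true  true  false = refl
  bits true  false true  = refl
  bits true  false false = refl
  bits false true  true  = refl
  bits false true  false = refl
  bits false false c     = refl

+ᵥ-self : ∀ {n} (x : 𝔽₂^ n) → x +ᵥ x ≡ 0ᵥ
+ᵥ-self []          = refl
+ᵥ-self (false ∷ x) = cong (false ∷_) (+ᵥ-self x)
+ᵥ-self (true  ∷ x) = cong (false ∷_) (+ᵥ-self x)

+ᵥ-involutive : ∀ {n} (x y : 𝔽₂^ n) → x +ᵥ (x +ᵥ y) ≡ y
+ᵥ-involutive []          []      = refl
+ᵥ-involutive (false ∷ x) (b ∷ y) = cong (b ∷_) (+ᵥ-involutive x y)
+ᵥ-involutive (true  ∷ x) (b ∷ y) = cong₂ _∷_ (not-involutive b) (+ᵥ-involutive x y)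

+ᵥ-cancelˡ : ∀ {n} (x : 𝔽₂^ n) {y z} → x +ᵥ y ≡ x +ᵥ z → y ≡ z
+ᵥ-cancelˡ x {y} {z} eq =
  trans (sym (+ᵥ-involutive x y)) (trans (cong (x +ᵥ_) eq) (+ᵥ-involutive x z))

-- Turns a congruence between the second summands of two equal sums into one between the first
-- summands.
+ᵥ-exchange : ∀ {n} (x y x′ y′ : 𝔽₂^ n) → x +ᵥ y ≡ x′ +ᵥ y′ → y +ᵥ y′ ≡ x +ᵥ x′
+ᵥ-exchange x y x′ y′ eq =
  trans (+ᵥ-comm y y′)
 (trans (sym (+ᵥ-telescope y′ x′ y))
 (trans (cong (_+ᵥ (x′ +ᵥ y)) (trans (+ᵥ-comm y′ x′) (sym eq)))
 (trans (cong ((x +ᵥ y) +ᵥ_) (+ᵥ-comm x′ y))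
        (+ᵥ-telescope x y x′))))

module _ {n} (V : Subspace n) where

  infix 4 _∼_

  -- Congruence modulo `V`: over 𝔽₂ the difference of `x` and `y` is their sum.
  _∼_ : 𝔽₂^ n → 𝔽₂^ n → Set
  x ∼ y = x +ᵥ y ∈ carrier V

  ∼-refl : ∀ {x} → x ∼ x
  ∼-refl {x} = subst (_∈ carrier V) (sym (+ᵥ-self x)) (Subspace.0∈ V)

  ∼-sym : ∀ {x y} → x ∼ y → y ∼ x
  ∼-sym {x} {y} = subst (_∈ carrier V) (+ᵥ-comm x y)

  ∼-trans : ∀ {x y z} → x ∼ y → y ∼ z → x ∼ z
  ∼-trans {x} {y} {z} x∼y y∼z =
    subst (_∈ carrier V) (+ᵥ-telescope x y z) (Subspace.+-closed V x∼y y∼z)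

  cosetDecSetoid : DecSetoid _ _
  cosetDecSetoid = record
    { _≈_ = _∼_
    ; isDecEquivalence = record
      { isEquivalence = record
        { refl  = λ {x} → ∼-refl {x}
        ; sym   = λ {x} {y} → ∼-sym {x} {y}
        ; trans = λ {x} {y} {z} → ∼-trans {x} {y} {z}
        }
      ; _≟_ = λ x y → T? (carrier V (x +ᵥ y))
      }
    }

  ∈-⊕-∼⁺ : ∀ (S : Subset n) {s x} → s ∈ S → s ∼ x → x ∈ S ⊕ carrier V
  ∈-⊕-∼⁺ S {s} {x} s∈S s∼x =
    subst (_∈ S ⊕ carrier V) (+ᵥ-involutive s x) (∈-⊕⁺ {S = S} {U = carrier V} s∈S s∼x)

  ∈-⊕-∼⁻ : ∀ (S : Subset n) {x} → x ∈ S ⊕ carrier V → ∃[ s ] s ∈ S × s ∼ x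
  ∈-⊕-∼⁻ S x∈ =
    let s , v , s∈S , v∈V , s+v≡x = ∈-⊕⁻ {S = S} {U = carrier V} x∈
    in s , s∈S , subst (_∈ carrier V) (trans (sym (+ᵥ-involutive s v)) (cong (s +ᵥ_) s+v≡x)) v∈V

  -- Coset representatives and the covering inequality

  representatives : Subset n → List (𝔽₂^ n)
  representatives A = deduplicate (DecSetoid._≟_ cosetDecSetoid) (members A)

  ∈-representatives⁻ : ∀ A {x} → x ∈ˡ representatives A → x ∈ A
  ∈-representatives⁻ A =
    ∈-members⁻ A ∘ ∈-deduplicate⁻ (DecSetoid._≟_ cosetDecSetoid) (members A)

  representatives-cover : ∀ A → A ⊆ fromList (representatives A) ⊕ carrier V
  representatives-cover A x x∈A =
    -- The point `x` itself may be removed by the deduplication. But the predicate `_∼ x` is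
    -- constant on cosets, so some point satisfying it survives.
    let y , y∈ , y∼x = find (deduplicate⁺ (DecSetoid._≟_ cosetDecSetoid) {P = _∼ x}
                              (λ {y} {z} z∼y y∼x → ∼-trans {z} {y} {x} z∼y y∼x)
                              (lose (∈-members⁺ A x∈A) (∼-refl {x})))
    in ∈-⊕-∼⁺ (fromList (representatives A)) (fromWitness y∈) y∼x

  representatives-≁ : ∀ A → AllPairs (λ x y → ¬ x ∼ y) (representatives A)
  representatives-≁ A = deduplicate-! cosetDecSetoid (members A)

  representatives-unique : ∀ A → Unique (representatives A)
  representatives-unique A =
    AllPairs.map (λ {x} x≁y x≡y → x≁y (subst (x ∼_) x≡y (∼-refl {x}))) (representatives-≁ A)

  -- `AllPairs` compares an entry only with later ones, so when `y` is at the head and `x` comes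
  -- later the congruence has to be reversed by symmetry.
  AllPairs-≁⇒≡ : ∀ {xs} → AllPairs (λ x y → ¬ x ∼ y) xs →
                 ∀ {x y} → x ∈ˡ xs → y ∈ˡ xs → x ∼ y → x ≡ y
  AllPairs-≁⇒≡ _        (here refl) (here refl) _ = refl
  AllPairs-≁⇒≡ (≁ ∷ _)  (here refl) (there y∈)  x∼y = contradiction x∼y (All.lookup ≁ y∈)
  AllPairs-≁⇒≡ (≁ ∷ _)  {x} {y} (there x∈) (here refl) x∼y =
    contradiction (∼-sym {x} {y} x∼y) (All.lookup ≁ x∈)
  AllPairs-≁⇒≡ (_ ∷ ps) (there x∈)  (there y∈)  x∼y = AllPairs-≁⇒≡ ps x∈ y∈ x∼y

  -- Passes from a covering of the part `C` to one of all of `A`: the larger `C` is and the smaller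
  -- `A ⊕ A` is, the less is lost.
  𝒩*∣∣≤∣∣*∣⊕∣ : ∀ (A C U : Subset n) → C ⊆ A → C ⊆ U ⊕ carrier V →
                𝒩 V A ℕ.* ∣ C ∣ ℕ.≤ ∣ U ∣ ℕ.* ∣ A ⊕ A ∣
  𝒩*∣∣≤∣∣*∣⊕∣ A C U C⊆A C⊆U⊕V = begin
    𝒩 V A ℕ.* ∣ C ∣
      ≤⟨ ℕ.*-monoˡ-≤ ∣ C ∣ (𝒩-minimal V A (fromList X) (representatives-cover A)) ⟩
    ∣ fromList X ∣ ℕ.* ∣ C ∣
      ≤⟨ ℕ.*-monoˡ-≤ ∣ C ∣ (∣fromList∣≤length X) ⟩
    length X ℕ.* length (members C)
      ≡⟨ sym (length-cartesianProduct X (members C)) ⟩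
    length (cartesianProduct X (members C))
      ≤⟨ length-≤ _⟶_ (cartesianProduct⁺ (representatives-unique A) (members-unique C))
           total leftUnique ⟩
    length (cartesianProduct (members U) (members (A ⊕ A)))
      ≡⟨ length-cartesianProduct (members U) (members (A ⊕ A)) ⟩
    ∣ U ∣ ℕ.* ∣ A ⊕ A ∣ ∎
    where
    open ℕ.≤-Reasoning
    X = representatives A

    -- Any `u` congruent to `c` is allowed, so no canonical choice of u(c) has to be fixed.
    -- Membership of `x` in `X` is recorded because left uniqueness relies on it.
    _⟶_ : 𝔽₂^ n × 𝔽₂^ n → 𝔽₂^ n × 𝔽₂^ n → Set
    (x , c) ⟶ (u , s) = x ∈ˡ X × u ∼ c × x +ᵥ c ≡ s

    total : ∀ {p} → p ∈ˡ cartesianProduct X (members C) →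
            ∃[ q ] q ∈ˡ cartesianProduct (members U) (members (A ⊕ A)) × p ⟶ q
    total {x , c} p∈ =
      let x∈ , c∈        = ∈-cartesianProduct⁻ X (members C) p∈
          c∈C            = ∈-members⁻ C c∈
          u , u∈U , u∼c  = ∈-⊕-∼⁻ U (C⊆U⊕V c c∈C)
      in (u , x +ᵥ c)
       , ∈-cartesianProduct⁺ (∈-members⁺ U u∈U)
           (∈-members⁺ (A ⊕ A) (∈-⊕⁺ {S = A} {U = A} (∈-representatives⁻ A x∈) (C⊆A c c∈C)))
       , x∈ , u∼c , refl

    leftUnique : ∀ {p p′ q} → p ⟶ q → p′ ⟶ q → p ≡ p′
    leftUnique {x , c} {x′ , c′} {u , s} (x∈ , u∼c , eq) (x′∈ , u∼c′ , eq′)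
      -- From `c ∼ u ∼ c′` and the equality of `x +ᵥ c` and `x′ +ᵥ c′` follows `x ∼ x′`. Distinct
      -- representatives are incongruent, so `x` and `x′` agree, and cancelling `x` identifies `c`
      -- with `c′`.
      with AllPairs-≁⇒≡ (representatives-≁ A) x∈ x′∈
             (subst (_∈ carrier V) (+ᵥ-exchange x c x′ c′ (trans eq (sym eq′)))
               (∼-trans {c} {u} {c′} (∼-sym {u} {c} u∼c) u∼c′))
    ... | refl = cong (x ,_) (+ᵥ-cancelˡ x (trans eq (sym eq′)))

-- Ordered fields

module _ {c ℓ₁ ℓ₂} (ℝ : Reals c ℓ₁ ℓ₂) where
  open Reals ℝ renaming (refl to ≈-refl; sym to ≈-sym; trans to ≈-trans; zero to *-zero)
  open IsDecTotalOrder isDecTotalOrder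
    using (total; antisym; isPartialOrder; _≤?_; ≤-respʳ-≈)
    renaming (refl to ≤-refl; reflexive to ≤-reflexive; trans to ≤-trans)
  open import Algebra.Properties.Semiring.Mult semiring using (×-homo-+; ×1-homo-*; ×-homo-1)
  open import Algebra.Solver.Ring.NaturalCoefficients.Default commutativeSemiring
    using (solve; _:+_; _:*_; _:=_)

  ≤-poset : Poset _ _ _
  ≤-poset = record { isPartialOrder = isPartialOrder }

  open import Relation.Binary.Reasoning.PartialOrder ≤-poset

  +-monoʳ-≤ : ∀ z {x y} → x ≤ y → z + x ≤ z + y
  +-monoʳ-≤ z {x} {y} x≤y = begin
    z + x ≈⟨ +-comm z x ⟩
    x + z ≤⟨ +-monoˡ-≤ z x≤y ⟩
    y + z ≈⟨ +-comm y z ⟩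
    z + y ∎

  +-mono-≤ : ∀ {w x y z} → w ≤ x → y ≤ z → w + y ≤ x + z
  +-mono-≤ {x = x} {y} w≤x y≤z = ≤-trans (+-monoˡ-≤ y w≤x) (+-monoʳ-≤ x y≤z)

  +-cancelʳ-≤ : ∀ z {x y} → x + z ≤ y + z → x ≤ y
  +-cancelʳ-≤ z {x} {y} x+z≤y+z = begin
    x              ≈⟨ cancel x ⟨
    (x + z) + - z  ≤⟨ +-monoˡ-≤ (- z) x+z≤y+z ⟩
    (y + z) + - z  ≈⟨ cancel y ⟩
    y              ∎
    where
    cancel : ∀ w → (w + z) + - z ≈ w
    cancel w = ≈-trans (+-assoc w z (- z)) (≈-trans (+-congˡ (-‿inverseʳ z)) (+-identityʳ w))

  -‿cancel : ∀ x y → (x - y) + y ≈ x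
  -‿cancel x y = ≈-trans (+-assoc x (- y) y) (≈-trans (+-congˡ (-‿inverseˡ y)) (+-identityʳ x))

  x≤y⇒0≤y-x : ∀ {x y} → x ≤ y → 0# ≤ y - x
  x≤y⇒0≤y-x {x} {y} x≤y = begin
    0#    ≈⟨ -‿inverseʳ x ⟨
    x - x ≤⟨ +-monoˡ-≤ (- x) x≤y ⟩
    y - x ∎

  *-monoʳ-≤ : ∀ {x y z} → 0# ≤ z → x ≤ y → z * x ≤ z * y
  *-monoʳ-≤ {x} {y} {z} 0≤z x≤y = begin
    z * x               ≈⟨ +-identityˡ (z * x) ⟨
    0# + z * x          ≤⟨ +-monoˡ-≤ (z * x) (*-nonNeg 0≤z (x≤y⇒0≤y-x x≤y)) ⟩
    z * (y - x) + z * x ≈⟨ distribˡ z (y - x) x ⟨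
    z * ((y - x) + x)   ≈⟨ *-congˡ (-‿cancel y x) ⟩
    z * y               ∎

  *-monoˡ-≤ : ∀ {x y z} → 0# ≤ z → x ≤ y → x * z ≤ y * z
  *-monoˡ-≤ {x} {y} {z} 0≤z x≤y = begin
    x * z ≈⟨ *-comm x z ⟩
    z * x ≤⟨ *-monoʳ-≤ 0≤z x≤y ⟩
    z * y ≈⟨ *-comm z y ⟩
    y * z ∎

  -- If 1 ≤ 0, then -1 is nonnegative, and hence so is its square 1.
  0≤1 : 0# ≤ 1#
  0≤1 with total 0# 1#
  ... | inj₁ 0≤1 = 0≤1
  ... | inj₂ 1≤0 = begin
    0#                     ≤⟨ *-nonNeg 0≤-1 0≤-1 ⟩
    (0# - 1#) * (0# - 1#)  ≈⟨ *-cong (+-identityˡ (- 1#)) (+-identityˡ (- 1#)) ⟩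
    - 1# * - 1#            ≈⟨ -1*x≈-x (- 1#) ⟩
    - - 1#                 ≈⟨ -‿involutive 1# ⟩
    1#                     ∎
    where
    open import Algebra.Properties.Ring ring using (-1*x≈-x; -‿involutive)
    0≤-1 : 0# ≤ 0# - 1#
    0≤-1 = x≤y⇒0≤y-x 1≤0

  1≰0 : ¬ (1# ≤ 0#)
  1≰0 1≤0 = 1≉0 (antisym 1≤0 0≤1)

  -- Were `x ⁻¹` at most 0, multiplying by `x` would give 1 ≤ 0.
  ⁻¹-nonNeg : ∀ {x} → 0# ≤ x → ¬ (x ≈ 0#) → 0# ≤ x ⁻¹
  ⁻¹-nonNeg {x} 0≤x x≉0 with total 0# (x ⁻¹)
  ... | inj₁ 0≤x⁻¹ = 0≤x⁻¹
  ... | inj₂ x⁻¹≤0 = contradiction 1≤0 1≰0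
    where
    1≤0 : 1# ≤ 0#
    1≤0 = begin
      1#       ≈⟨ ⁻¹-inverseʳ x≉0 ⟨
      x * x ⁻¹ ≤⟨ *-monoʳ-≤ 0≤x x⁻¹≤0 ⟩
      x * 0#   ≈⟨ zeroʳ x ⟩
      0#       ∎

  x*y≤z⇒y≤x⁻¹*z : ∀ {x y z} → 0# ≤ x → ¬ (x ≈ 0#) → x * y ≤ z → y ≤ x ⁻¹ * z
  x*y≤z⇒y≤x⁻¹*z {x} {y} {z} 0≤x x≉0 xy≤z = begin
    y              ≈⟨ *-identityˡ y ⟨
    1# * y         ≈⟨ *-congʳ (⁻¹-inverseʳ x≉0) ⟨
    x * x ⁻¹ * y   ≈⟨ solve 3 (λ x i y → x :* i :* y := i :* (x :* y)) ≈-refl x (x ⁻¹) y ⟩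
    x ⁻¹ * (x * y) ≤⟨ *-monoʳ-≤ (⁻¹-nonNeg 0≤x x≉0) xy≤z ⟩
    x ⁻¹ * z       ∎

  *-cancelˡ-≤ : ∀ {x y z} → 0# ≤ x → ¬ (x ≈ 0#) → x * y ≤ x * z → y ≤ z
  *-cancelˡ-≤ {x} {y} {z} 0≤x x≉0 xy≤xz = begin
    y              ≤⟨ x*y≤z⇒y≤x⁻¹*z 0≤x x≉0 xy≤xz ⟩
    x ⁻¹ * (x * z) ≈⟨ solve 3 (λ x i z → i :* (x :* z) := x :* i :* z) ≈-refl x (x ⁻¹) z ⟩
    x * x ⁻¹ * z   ≈⟨ *-congʳ (⁻¹-inverseʳ x≉0) ⟩
    1# * z         ≈⟨ *-identityˡ z ⟩
    z              ∎

  -- Natural numbers in the ordered field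

  fromℕ-nonNeg : ∀ m → 0# ≤ fromℕ m
  fromℕ-nonNeg zero    = ≤-refl
  fromℕ-nonNeg (suc m) = begin
    0#             ≈⟨ +-identityˡ 0# ⟨
    0# + 0#        ≤⟨ +-mono-≤ 0≤1 (fromℕ-nonNeg m) ⟩
    1# + fromℕ m   ∎

  fromℕ-mono-≤ : ∀ {m n} → m ℕ.≤ n → fromℕ m ≤ fromℕ n
  fromℕ-mono-≤ {n = n} z≤n = fromℕ-nonNeg n
  fromℕ-mono-≤ (s≤s m≤n)   = +-monoʳ-≤ 1# (fromℕ-mono-≤ m≤n)

  fromℕ-+ : ∀ m n → fromℕ (m ℕ.+ n) ≈ fromℕ m + fromℕ n
  fromℕ-+ m n = ×-homo-+ 1# m n

  fromℕ-* : ∀ m n → fromℕ (m ℕ.* n) ≈ fromℕ m * fromℕ n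
  fromℕ-* = ×1-homo-*

  fromℕ≉0 : ∀ {m} → 0 ℕ.< m → ¬ (fromℕ m ≈ 0#)
  fromℕ≉0 {m} 0<m m≈0 = 1≰0 (begin
    1#      ≈⟨ ×-homo-1 1# ⟨
    fromℕ 1 ≤⟨ fromℕ-mono-≤ 0<m ⟩
    fromℕ m ≈⟨ m≈0 ⟩
    0#      ∎)

  -- The class 𝔄(B; K, η)

  -- The list `subsets` contains every subset only up to pointwise equality, so a member of the
  -- class must be exchangeable for its listed copy.
  𝔄-resp-≗ : ∀ {n} (B : Subset n) K η {A A′ : Subset n} → A ≗ A′ → 𝔄 ℝ B K η A → 𝔄 ℝ B K η A′
  𝔄-resp-≗ B K η {A} {A′} A≗A′ ((x , x∈A) , doubling , close) =
    (x , subst T (A≗A′ x) x∈A) ,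
    (begin
      fromℕ ∣ A′ ⊕ A′ ∣ ≤⟨ fromℕ-mono-≤ (∣∣-mono-⊆ (A′ ⊕ A′) (A ⊕ A) (⊕-mono-⊆ A′ A A′ A A′⊆A A′⊆A)) ⟩
      fromℕ ∣ A ⊕ A ∣   ≤⟨ doubling ⟩
      K * fromℕ ∣ A ∣   ≡⟨ cong (λ m → K * fromℕ m) ∣A∣≡∣A′∣ ⟩
      K * fromℕ ∣ A′ ∣  ∎) ,
    subst₂ (λ l m → fromℕ l ≤ η * fromℕ m)
      (∣∣-cong {S = A △ B} {U = A′ △ B} (λ x → cong (_xor B x) (A≗A′ x))) ∣A∣≡∣A′∣ close
    where
    ∣A∣≡∣A′∣ = ∣∣-cong {S = A} {U = A′} A≗A′
    A′⊆A : A′ ⊆ A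
    A′⊆A x = subst T (sym (A≗A′ x))

  𝔄? : ∀ {n} (B : Subset n) K η (A : Subset n) → Dec (𝔄 ℝ B K η A)
  𝔄? B K η A = nonempty? A ×-dec (fromℕ ∣ A ⊕ A ∣ ≤? K * fromℕ ∣ A ∣)
                           ×-dec (fromℕ ∣ A △ B ∣ ≤? η * fromℕ ∣ A ∣)

  -- Membership in the class is decidable, because the order of the reals is, and there are finitely
  -- many subsets up to pointwise equality; so a minimum can be found by search.
  𝔄-smallest : ∀ {n} (B : Subset n) K η → Satisfiable (𝔄 ℝ B K η) →
               ∃[ A₀ ] 𝔄 ℝ B K η A₀ × (∀ A → 𝔄 ℝ B K η A → ∣ A₀ ∣ ℕ.≤ ∣ A ∣)
  𝔄-smallest {n} B K η (W , W∈) =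
    -- The given member `W` is the default of `argmin`, so the result lies in the class even when it
    -- is that default.
    argmin ∣_∣ W class ,
    argmin-all ∣_∣ {P = 𝔄 ℝ B K η} W∈ (all-filter (𝔄? B K η) (subsets n)) ,
    λ A A∈ →
      let A′ , A′∈ˡ , A≗A′ = subsets-complete A
      in subst (∣ argmin ∣_∣ W class ∣ ℕ.≤_) (sym (∣∣-cong A≗A′))
           (All.lookup (f[argmin]≤f[xs] {f = ∣_∣} W class)
             (∈-filter⁺ (𝔄? B K η) A′∈ˡ (𝔄-resp-≗ B K η A≗A′ A∈)))
    where
    class : List (Subset n)
    class = filter (𝔄? B K η) (subsets n)

  -- By `count-∧-△`, |A| + |A₀| exceeds 2|A ∩ A₀| by at most the two distances to `B`, whose sum is
  -- at most η(|A| + |A₀|). This term is added to both sides and cancelled at the end.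
  𝔄-∩-large : ∀ {n} (B : Subset n) K η (A A₀ : Subset n) → 𝔄 ℝ B K η A → 𝔄 ℝ B K η A₀ →
              (1# - η) * (fromℕ ∣ A ∣ + fromℕ ∣ A₀ ∣) ≤ fromℕ 2 * fromℕ ∣ A ∩ A₀ ∣
  𝔄-∩-large {n} B K η A A₀ (_ , _ , close) (_ , _ , close₀) = +-cancelʳ-≤ (η * (a + a₀)) (begin
    (1# - η) * (a + a₀) + η * (a + a₀)
      ≈⟨ distribʳ (a + a₀) (1# - η) η ⟨
    ((1# - η) + η) * (a + a₀)
      ≈⟨ *-congʳ (-‿cancel 1# η) ⟩
    1# * (a + a₀)
      ≈⟨ *-identityˡ (a + a₀) ⟩
    a + a₀
      ≈⟨ fromℕ-+ ∣ A ∣ ∣ A₀ ∣ ⟨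
    fromℕ (∣ A ∣ ℕ.+ ∣ A₀ ∣)
      ≤⟨ fromℕ-mono-≤ (count-∧-△ A A₀ B (points n)) ⟩
    fromℕ (2 ℕ.* ∣ A ∩ A₀ ∣ ℕ.+ (∣ A △ B ∣ ℕ.+ ∣ A₀ △ B ∣))
      ≈⟨ fromℕ-+ (2 ℕ.* ∣ A ∩ A₀ ∣) (∣ A △ B ∣ ℕ.+ ∣ A₀ △ B ∣) ⟩
    fromℕ (2 ℕ.* ∣ A ∩ A₀ ∣) + fromℕ (∣ A △ B ∣ ℕ.+ ∣ A₀ △ B ∣)
      ≈⟨ +-cong (fromℕ-* 2 ∣ A ∩ A₀ ∣) (fromℕ-+ ∣ A △ B ∣ ∣ A₀ △ B ∣) ⟩
    fromℕ 2 * fromℕ ∣ A ∩ A₀ ∣ + (fromℕ ∣ A △ B ∣ + fromℕ ∣ A₀ △ B ∣)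
      ≤⟨ +-monoʳ-≤ _ (+-mono-≤ close close₀) ⟩
    fromℕ 2 * fromℕ ∣ A ∩ A₀ ∣ + (η * a + η * a₀)
      ≈⟨ +-congˡ (distribˡ η a a₀) ⟨
    fromℕ 2 * fromℕ ∣ A ∩ A₀ ∣ + η * (a + a₀) ∎)
    where
    a  = fromℕ ∣ A ∣
    a₀ = fromℕ ∣ A₀ ∣

  𝒩-bound : ∀ {n} (V : Subspace n) (B : Subset n) K η p (A A₀ : Subset n) → 0# ≤ p → η < 1# →
            𝔄 ℝ B K η A → 𝔄 ℝ B K η A₀ → fromℕ (𝒩 V A₀) ≤ p →
            fromℕ (𝒩 V A) ≤ (fromℕ 2 * K) / (1# - η) * p
  𝒩-bound V B K η p A A₀ 0≤p (η≤1 , η≉1) A∈@(nonempty , doubling , _) A₀∈ 𝒩≤p =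
    -- An optimal covering of `A₀` also covers its subset `C`, which lies in `A` as well.
    let U , A₀⊆U⊕V , ∣U∣≡𝒩 = 𝒩-attained V A₀
        counting = 𝒩*∣∣≤∣∣*∣⊕∣ V A C U
          (λ x → proj₁ ∘ Equivalence.to (T-∧ {A x}))
          (λ x → A₀⊆U⊕V x ∘ proj₂ ∘ Equivalence.to (T-∧ {A x}))
        N*∣C∣≤p*K*a = begin
          N * fromℕ ∣ C ∣                   ≈⟨ fromℕ-* (𝒩 V A) ∣ C ∣ ⟨
          fromℕ (𝒩 V A ℕ.* ∣ C ∣)           ≤⟨ fromℕ-mono-≤ counting ⟩
          fromℕ (∣ U ∣ ℕ.* ∣ A ⊕ A ∣)       ≈⟨ fromℕ-* ∣ U ∣ ∣ A ⊕ A ∣ ⟩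
          fromℕ ∣ U ∣ * fromℕ ∣ A ⊕ A ∣     ≡⟨ cong (λ m → fromℕ m * fromℕ ∣ A ⊕ A ∣) ∣U∣≡𝒩 ⟩
          fromℕ (𝒩 V A₀) * fromℕ ∣ A ⊕ A ∣  ≤⟨ *-monoˡ-≤ (fromℕ-nonNeg ∣ A ⊕ A ∣) 𝒩≤p ⟩
          p * fromℕ ∣ A ⊕ A ∣               ≤⟨ *-monoʳ-≤ 0≤p doubling ⟩
          p * (K * a)                       ∎
        -- The doubling bound brings in a factor |A|. It cancels against the lower bound q|A| ≤
        -- 2|C|, got by discarding |A₀| from the sum; this is where the constant 2K/(1 - η) comes
        -- from.
        q*N≤2*K*p = *-cancelˡ-≤ (fromℕ-nonNeg ∣ A ∣) (fromℕ≉0 (Nonempty⇒0<∣∣ A nonempty)) (begin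
          a * (q * N)
            ≈⟨ solve 3 (λ a q N → a :* (q :* N) := N :* (q :* a)) ≈-refl a q N ⟩
          N * (q * a)
            ≤⟨ *-monoʳ-≤ 0≤N (*-monoʳ-≤ 0≤q a≤a+a₀) ⟩
          N * (q * (a + a₀))
            ≤⟨ *-monoʳ-≤ 0≤N (𝔄-∩-large B K η A A₀ A∈ A₀∈) ⟩
          N * (fromℕ 2 * fromℕ ∣ C ∣)
            ≈⟨ solve 3 (λ N t c → N :* (t :* c) := t :* (N :* c)) ≈-refl N (fromℕ 2) (fromℕ ∣ C ∣) ⟩
          fromℕ 2 * (N * fromℕ ∣ C ∣)
            ≤⟨ *-monoʳ-≤ (fromℕ-nonNeg 2) N*∣C∣≤p*K*a ⟩
          fromℕ 2 * (p * (K * a))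
            ≈⟨ solve 4 (λ t p K a → t :* (p :* (K :* a)) := a :* (t :* K :* p)) ≈-refl (fromℕ 2) p K a ⟩
          a * (fromℕ 2 * K * p) ∎)
    in begin
      N                                ≤⟨ x*y≤z⇒y≤x⁻¹*z 0≤q q≉0 q*N≤2*K*p ⟩
      q ⁻¹ * (fromℕ 2 * K * p)         ≈⟨ solve 3 (λ i k p → i :* (k :* p) := k :* i :* p) ≈-refl (q ⁻¹) (fromℕ 2 * K) p ⟩
      (fromℕ 2 * K) / q * p            ∎
    where
    C  = A ∩ A₀
    N  = fromℕ (𝒩 V A)
    q  = 1# - η
    a  = fromℕ ∣ A ∣
    a₀ = fromℕ ∣ A₀ ∣

    0≤N : 0# ≤ N
    0≤N = fromℕ-nonNeg (𝒩 V A)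

    0≤q : 0# ≤ q
    0≤q = x≤y⇒0≤y-x η≤1

    q≉0 : ¬ (q ≈ 0#)
    q≉0 q≈0 = η≉1 (begin-equality
      η      ≈⟨ +-identityˡ η ⟨
      0# + η ≈⟨ +-congʳ q≈0 ⟨
      q + η  ≈⟨ -‿cancel 1# η ⟩
      1#     ∎)

    a≤a+a₀ : a ≤ a + a₀
    a≤a+a₀ = begin
      a      ≈⟨ +-identityʳ a ⟨
      a + 0# ≤⟨ +-monoʳ-≤ a (fromℕ-nonNeg ∣ A₀ ∣) ⟩
      a + a₀ ∎

theorem2p6 : ∀ {c ℓ₁ ℓ₂} (ℝ : Reals c ℓ₁ ℓ₂) (P-PFR : PFRPolynomial ℝ) →
    let open Reals ℝ
        open PFRPolynomial P-PFR using (P)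
    in ∀ (n : ℕ) → 1 ℕ.≤ n → (B : Subset n) (K η : Carrier) →
       1# ≤ K → 0# ≤ η → η < 1# →
       Satisfiable (𝔄 ℝ B K η) →
       ∃[ V ] (∀ (A : Subset n) → 𝔄 ℝ B K η A →
         ∣ carrier V ∣ ℕ.≤ ∣ A ∣ ×
         fromℕ (𝒩 V A) ≤ (fromℕ 2 * K) / (1# - η) * P K)
theorem2p6 ℝ P-PFR n _ B K η 1≤K _ η<1 satisfiable =
  let open Reals ℝ using (isDecTotalOrder)
      open PFRPolynomial P-PFR using (P; P≥1; pfr)
      A₀ , A₀∈@(nonempty , doubling , _) , smallest = 𝔄-smallest ℝ B K η satisfiable
      -- `V` is obtained from `A₀` alone, before any `A` is given, so it serves the whole class.
      V , ∣V∣≤∣A₀∣ , 𝒩≤P = pfr 1≤K A₀ nonempty doubling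
      0≤P = IsDecTotalOrder.trans isDecTotalOrder (0≤1 ℝ) (P≥1 1≤K)
  in V , λ A A∈ →
       -- Minimality of `A₀` turns the size bound for this one set into a bound for every `A`.
       ℕ.≤-trans ∣V∣≤∣A₀∣ (smallest A A∈) ,
       𝒩-bound ℝ V B K η (P K) A A₀ 0≤P η<1 A∈ A₀∈ 𝒩≤P
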